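{- Let $\mathbf{X}$ be an $\mathcal{M},\mathcal{N}$-adhesive category with pullbacks such that $\mathcal{M}\cap\mathcal{N}$ contains all split monomorphisms and $\mathcal{N}$ contains all $\mathcal{M},\mathcal{N}$-codiagonals. Then there exists a full and faithful functor from $\mathbf{X}$ into a topos, preserving all pullbacks and $\mathcal{M},\mathcal{N}$-pushouts.
   Context: Classes of arrows. A class $\mathcal{A}$ of arrows is stable under pullbacks (resp. pushouts) if for every pullback (resp. pushout) square with $f:A\to B$, $m:A\to C$, $n:B\to D$, $g:C\to D$, $n\circ f=g\circ m$, $n\in\mathcal{A}$ implies $m\in\mathcal{A}$ (resp. $m\in\mathcal{A}$ implies $n\in\mathcal{A}$); existence of the (co)limits is not assumed. $\mathcal{A}$ is closed under $\mathcal{B}$-decomposition if $g\circ f\in\mathcal{A}$ and $g\in\mathcal{B}$ imply $f\in\mathcal{A}$; closed under decomposition means closed under $\mathcal{A}$-decomposition. Preadhesive structure. A pair $(\mathcal{M},\mathcal{N})$ with $\mathcal{M}$ a class of monomorphisms and $\mathcal{N}$ a class of arrows of $\mathbf{X}$ such that: (1) $\mathcal{M}$ and $\mathcal{N}$ contain all isomorphisms and are closed under composition and decomposition; (2) $\mathcal{N}$ is closed under $\mathcal{M}$-decomposition; (3) $\mathcal{M}$ and $\mathcal{N}$ are stable under pullbacks and pushouts. Van Kampen squares. A pushout square $g:A\to B$, $m:A\to C$, $n:B\to D$, $f:C\to D$ is Van Kampen if for every commutative cube having it as bottom face, with top face $g':A'\to B'$, $m':A'\to C'$, $n':B'\to D'$,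 $f':C'\to D'$ and vertical arrows $a:A'\to A$, $b:B'\to B$, $c:C'\to C$, $d:D'\to D$, such that the two vertical faces containing $a$ are pullbacks, the top face is a pushout if and only if the two vertical faces containing $d$ are pullbacks. $\mathcal{M},\mathcal{N}$-adhesivity. $\mathbf{X}$ is $\mathcal{M},\mathcal{N}$-adhesive if $(\mathcal{M},\mathcal{N})$ is a preadhesive structure on $\mathbf{X}$ and: (1) pullbacks of arrows in $\mathcal{M}$ along arbitrary arrows exist; (2) for $m:X\to Y$ in $\mathcal{M}$ and $n:X\to Z$ in $\mathcal{N}$ a pushout of $m$ and $n$ exists (an $\mathcal{M},\mathcal{N}$-pushout); (3) $\mathcal{M},\mathcal{N}$-pushouts are Van Kampen squares. Codiagonals. If $f:X\to Y$ admits a pushout along itself, with coprojections $y_1,y_2:Y\rightrightarrows Q_f$, its codiagonal $\upsilon_f:Q_f\to Y$ is the unique arrow with $\upsilon_f\circ y_1=\mathrm{id}_Y=\upsilon_f\circ y_2$. An $\mathcal{M},\mathcal{N}$-codiagonal is the codiagonal of an arrow $n\in\mathcal{M}\cap\mathcal{N}$. A topos is a finitely complete, cartesian closed category with a subobject classifier; the topos sought here is a Grothendieck topos (a category of sheaves of sets on a site with underlying category $\mathbf{X}$). "Preserving $\mathcal{M},\mathcal{N}$-pushouts" means sending $\mathcal{M},\mathcal{N}$-pushout squares to pushout squares. A split monomorphism is an arrow having a left inverse. -}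

-- Categories are enriched in setoids: arrows are compared by the hom-setoid
-- equality ≈, and existence is always a choice of witness.
module Defs where

open import Level using (Level; _⊔_; suc)
open import Data.Product using (Σ-syntax; _×_)
open import Function.Bundles using (Func; _⇔_)
import Function.Construct.Composition as Comp
import Function.Construct.Identity as Id
open import Relation.Binary.Bundles using (Setoid)
open import Relation.Binary.Structures using (IsEquivalence)

open Func using (to; cong)

record Category (o ℓ e : Level) : Set (suc (o ⊔ ℓ ⊔ e)) where
  infix  4 _≈_ _⇒_
  infixr 9 _∘_
  field
    Obj : Set o
    _⇒_ : Obj → Obj → Set ℓ
    _≈_ : ∀ {A B} → A ⇒ B → A ⇒ B → Set e
    id  : ∀ {A} → A ⇒ A
    _∘_ : ∀ {A B C} → B ⇒ C → A ⇒ B → A ⇒ C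
    assoc     : ∀ {A B C D} {f : A ⇒ B} {g : B ⇒ C} {h : C ⇒ D} →
                (h ∘ g) ∘ f ≈ h ∘ (g ∘ f)
    identityˡ : ∀ {A B} {f : A ⇒ B} → id ∘ f ≈ f
    identityʳ : ∀ {A B} {f : A ⇒ B} → f ∘ id ≈ f
    equiv     : ∀ {A B} → IsEquivalence (_≈_ {A} {B})
    ∘-resp-≈  : ∀ {A B C} {f h : B ⇒ C} {g i : A ⇒ B} →
                f ≈ h → g ≈ i → f ∘ g ≈ h ∘ i

  module Equiv {A B : Obj} = IsEquivalence (equiv {A} {B})

op : ∀ {o ℓ e} → Category o ℓ e → Category o ℓ e
op C = record
  { Obj       = Obj
  ; _⇒_       = λ A B → B ⇒ A
  ; _≈_       = _≈_
  ; id        = id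
  ; _∘_       = λ g f → f ∘ g
  ; assoc     = Equiv.sym assoc
  ; identityˡ = identityʳ
  ; identityʳ = identityˡ
  ; equiv     = equiv
  ; ∘-resp-≈  = λ p q → ∘-resp-≈ q p
  }
  where open Category C

Setoids : ∀ c ℓ → Category (suc (c ⊔ ℓ)) (c ⊔ ℓ) (c ⊔ ℓ)
Setoids c ℓ = record
  { Obj       = Setoid c ℓ
  ; _⇒_       = Func
  ; _≈_       = λ {_} {B} f g → ∀ x → Setoid._≈_ B (to f x) (to g x)
  ; id        = λ {A} → Id.function A
  ; _∘_       = λ g f → Comp.function f g
  ; assoc     = λ {_} {_} {_} {D} _ → Setoid.refl D
  ; identityˡ = λ {_} {B} _ → Setoid.refl B
  ; identityʳ = λ {_} {B} _ → Setoid.refl B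
  ; equiv     = λ {_} {B} → record
    { refl  = λ _ → Setoid.refl B
    ; sym   = λ p x → Setoid.sym B (p x)
    ; trans = λ p q x → Setoid.trans B (p x) (q x)
    }
  ; ∘-resp-≈  = λ {_} {_} {C} {_} {h} {g} {_} p q x →
      Setoid.trans C (p (to g x)) (cong h (q x))
  }

record Functor {o ℓ e o′ ℓ′ e′} (C : Category o ℓ e) (D : Category o′ ℓ′ e′)
       : Set (o ⊔ ℓ ⊔ e ⊔ o′ ⊔ ℓ′ ⊔ e′) where
  private
    module C = Category C
    module D = Category D
  field
    F₀ : C.Obj → D.Obj
    F₁ : ∀ {A B} → A C.⇒ B → F₀ A D.⇒ F₀ B
    identity     : ∀ {A} → F₁ (C.id {A}) D.≈ D.id
    homomorphism : ∀ {A B E} {f : A C.⇒ B} {g : B C.⇒ E} →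
                   F₁ (g C.∘ f) D.≈ F₁ g D.∘ F₁ f
    F-resp-≈     : ∀ {A B} {f g : A C.⇒ B} → f C.≈ g → F₁ f D.≈ F₁ g

record NaturalTransformation {o ℓ e o′ ℓ′ e′} {C : Category o ℓ e} {D : Category o′ ℓ′ e′}
       (F G : Functor C D) : Set (o ⊔ ℓ ⊔ ℓ′ ⊔ e′) where
  private
    module C = Category C
    module D = Category D
    module F = Functor F
    module G = Functor G
  field
    η       : ∀ A → F.F₀ A D.⇒ G.F₀ A
    commute : ∀ {A B} (f : A C.⇒ B) → η B D.∘ F.F₁ f D.≈ G.F₁ f D.∘ η A

module _ {o ℓ e} (X : Category o ℓ e) where
  open Category X

  IsMono : ∀ {A B} → A ⇒ B → Set (o ⊔ ℓ ⊔ e)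
  IsMono {A} m = ∀ {Z} {f g : Z ⇒ A} → m ∘ f ≈ m ∘ g → f ≈ g

  IsSplitMono : ∀ {A B} → A ⇒ B → Set (ℓ ⊔ e)
  IsSplitMono {A} {B} m = Σ[ r ∈ B ⇒ A ] r ∘ m ≈ id

  IsIso : ∀ {A B} → A ⇒ B → Set (ℓ ⊔ e)
  IsIso {A} {B} f = Σ[ g ∈ B ⇒ A ] (g ∘ f ≈ id × f ∘ g ≈ id)

  -- Both kinds of square are written  f : A ⇒ B, m : A ⇒ C, n : B ⇒ D,
  -- g : C ⇒ D  with  n ∘ f ≈ g ∘ m.

  record IsPullback {A B C D} (f : A ⇒ B) (m : A ⇒ C) (n : B ⇒ D) (g : C ⇒ D)
         : Set (o ⊔ ℓ ⊔ e) where
    field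
      commute   : n ∘ f ≈ g ∘ m
      universal : ∀ {Z} {h : Z ⇒ B} {k : Z ⇒ C} → n ∘ h ≈ g ∘ k → Z ⇒ A
      f∘universal≈h : ∀ {Z} {h : Z ⇒ B} {k : Z ⇒ C} {eq : n ∘ h ≈ g ∘ k} →
                      f ∘ universal eq ≈ h
      m∘universal≈k : ∀ {Z} {h : Z ⇒ B} {k : Z ⇒ C} {eq : n ∘ h ≈ g ∘ k} →
                      m ∘ universal eq ≈ k
      unique : ∀ {Z} {h : Z ⇒ B} {k : Z ⇒ C} {eq : n ∘ h ≈ g ∘ k} {u : Z ⇒ A} →
               f ∘ u ≈ h → m ∘ u ≈ k → u ≈ universal eq

  record IsPushout {A B C D} (f : A ⇒ B) (m : A ⇒ C) (n : B ⇒ D) (g : C ⇒ D)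
         : Set (o ⊔ ℓ ⊔ e) where
    field
      commute   : n ∘ f ≈ g ∘ m
      universal : ∀ {Z} {h : B ⇒ Z} {k : C ⇒ Z} → h ∘ f ≈ k ∘ m → D ⇒ Z
      universal∘n≈h : ∀ {Z} {h : B ⇒ Z} {k : C ⇒ Z} {eq : h ∘ f ≈ k ∘ m} →
                      universal eq ∘ n ≈ h
      universal∘g≈k : ∀ {Z} {h : B ⇒ Z} {k : C ⇒ Z} {eq : h ∘ f ≈ k ∘ m} →
                      universal eq ∘ g ≈ k
      unique : ∀ {Z} {h : B ⇒ Z} {k : C ⇒ Z} {eq : h ∘ f ≈ k ∘ m} {u : D ⇒ Z} →
               u ∘ n ≈ h → u ∘ g ≈ k → u ≈ universal eq

  record Pullback {B C D} (n : B ⇒ D) (g : C ⇒ D) : Set (o ⊔ ℓ ⊔ e) where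
    field
      {P} : Obj
      p₁  : P ⇒ B
      p₂  : P ⇒ C
      isPullback : IsPullback p₁ p₂ n g

  record Pushout {A B C} (f : A ⇒ B) (m : A ⇒ C) : Set (o ⊔ ℓ ⊔ e) where
    field
      {Q} : Obj
      i₁  : B ⇒ Q
      i₂  : C ⇒ Q
      isPushout : IsPushout f m i₁ i₂

  HasPullbacks : Set (o ⊔ ℓ ⊔ e)
  HasPullbacks = ∀ {B C D} (n : B ⇒ D) (g : C ⇒ D) → Pullback n g

  codiagonal : ∀ {A Y Q} {f : A ⇒ Y} {y₁ y₂ : Y ⇒ Q} → IsPushout f f y₁ y₂ → Q ⇒ Y
  codiagonal {f = f} po = IsPushout.universal po (Equiv.refl {x = id ∘ f})

  -- The cube has bottom face (g, m, n, f), top face (g′, m′, n′, f′) and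
  -- vertical arrows a, b, c, d; commutativity of the two faces containing a is
  -- part of their being pullbacks.
  IsVanKampen : ∀ {A B C D} (g : A ⇒ B) (m : A ⇒ C) (n : B ⇒ D) (f : C ⇒ D) →
                Set (o ⊔ ℓ ⊔ e)
  IsVanKampen {A} {B} {C} {D} g m n f =
    ∀ {A′ B′ C′ D′}
      (g′ : A′ ⇒ B′) (m′ : A′ ⇒ C′) (n′ : B′ ⇒ D′) (f′ : C′ ⇒ D′)
      (a : A′ ⇒ A) (b : B′ ⇒ B) (c : C′ ⇒ C) (d : D′ ⇒ D) →
      n′ ∘ g′ ≈ f′ ∘ m′ →
      d ∘ n′ ≈ n ∘ b →
      d ∘ f′ ≈ f ∘ c →
      IsPullback g′ a b g →
      IsPullback m′ a c m →
      IsPushout g′ m′ n′ f′ ⇔ (IsPullback n′ b d n × IsPullback f′ c d f)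

record ArrowClass {o ℓ e} (X : Category o ℓ e) (p : Level) : Set (o ⊔ ℓ ⊔ e ⊔ suc p) where
  open Category X
  field
    Has    : ∀ {A B} → A ⇒ B → Set p
    resp-≈ : ∀ {A B} {f g : A ⇒ B} → f ≈ g → Has f → Has g

module _ {o ℓ e} {X : Category o ℓ e} where
  open Category X

  infix 4 _∈_
  _∈_ : ∀ {p A B} → A ⇒ B → ArrowClass X p → Set p
  f ∈ 𝒜 = ArrowClass.Has 𝒜 f

  ContainsIsos : ∀ {p} → ArrowClass X p → Set (o ⊔ ℓ ⊔ e ⊔ p)
  ContainsIsos 𝒜 = ∀ {A B} {f : A ⇒ B} → IsIso X f → f ∈ 𝒜

  ClosedUnderComposition : ∀ {p} → ArrowClass X p → Set (o ⊔ ℓ ⊔ p)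
  ClosedUnderComposition 𝒜 =
    ∀ {A B C} {f : A ⇒ B} {g : B ⇒ C} → f ∈ 𝒜 → g ∈ 𝒜 → g ∘ f ∈ 𝒜

  ClosedUnderDecomposition : ∀ {p q} → ArrowClass X p → ArrowClass X q →
                             Set (o ⊔ ℓ ⊔ p ⊔ q)
  ClosedUnderDecomposition 𝒜 ℬ =
    ∀ {A B C} {f : A ⇒ B} {g : B ⇒ C} → g ∘ f ∈ 𝒜 → g ∈ ℬ → f ∈ 𝒜

  StableUnderPullbacks : ∀ {p} → ArrowClass X p → Set (o ⊔ ℓ ⊔ e ⊔ p)
  StableUnderPullbacks 𝒜 =
    ∀ {A B C D} {f : A ⇒ B} {m : A ⇒ C} {n : B ⇒ D} {g : C ⇒ D} →
    IsPullback X f m n g → n ∈ 𝒜 → m ∈ 𝒜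

  StableUnderPushouts : ∀ {p} → ArrowClass X p → Set (o ⊔ ℓ ⊔ e ⊔ p)
  StableUnderPushouts 𝒜 =
    ∀ {A B C D} {f : A ⇒ B} {m : A ⇒ C} {n : B ⇒ D} {g : C ⇒ D} →
    IsPushout X f m n g → m ∈ 𝒜 → n ∈ 𝒜

module _ {o ℓ e p q} (X : Category o ℓ e) (ℳ : ArrowClass X p) (𝒩 : ArrowClass X q) where
  open Category X

  record IsPreadhesive : Set (o ⊔ ℓ ⊔ e ⊔ p ⊔ q) where
    field
      ℳ-mono          : ∀ {A B} {m : A ⇒ B} → m ∈ ℳ → IsMono X m
      ℳ-isos          : ContainsIsos ℳ
      𝒩-isos          : ContainsIsos 𝒩
      ℳ-composition   : ClosedUnderComposition ℳ
      𝒩-composition   : ClosedUnderComposition 𝒩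
      ℳ-decomposition : ClosedUnderDecomposition ℳ ℳ
      𝒩-decomposition : ClosedUnderDecomposition 𝒩 𝒩
      𝒩-ℳ-decomposition : ClosedUnderDecomposition 𝒩 ℳ
      ℳ-pullbacks     : StableUnderPullbacks ℳ
      𝒩-pullbacks     : StableUnderPullbacks 𝒩
      ℳ-pushouts      : StableUnderPushouts ℳ
      𝒩-pushouts      : StableUnderPushouts 𝒩

  record IsAdhesive : Set (o ⊔ ℓ ⊔ e ⊔ p ⊔ q) where
    field
      preadhesive : IsPreadhesive
      pullbacks   : ∀ {B C D} (m : B ⇒ D) (g : C ⇒ D) → m ∈ ℳ → Pullback X m g
      pushouts    : ∀ {A B C} (m : A ⇒ B) (n : A ⇒ C) → m ∈ ℳ → n ∈ 𝒩 → Pushout X m n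
      vanKampen   : ∀ {A B C D} {m : A ⇒ B} {n : A ⇒ C} {i₁ : B ⇒ D} {i₂ : C ⇒ D} →
                    m ∈ ℳ → n ∈ 𝒩 → IsPushout X m n i₁ i₂ → IsVanKampen X m n i₁ i₂

  ContainSplitMonos : Set (o ⊔ ℓ ⊔ e ⊔ p ⊔ q)
  ContainSplitMonos = ∀ {A B} {s : A ⇒ B} → IsSplitMono X s → s ∈ ℳ × s ∈ 𝒩

  ContainsCodiagonals : Set (o ⊔ ℓ ⊔ e ⊔ p ⊔ q)
  ContainsCodiagonals =
    ∀ {A Y Q} {f : A ⇒ Y} {y₁ y₂ : Y ⇒ Q} → f ∈ ℳ → f ∈ 𝒩 →
    (po : IsPushout X f f y₁ y₂) → codiagonal X po ∈ 𝒩

module _ {o ℓ e o′ ℓ′ e′} {C : Category o ℓ e} {D : Category o′ ℓ′ e′} (F : Functor C D) where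
  private
    module C = Category C
    module D = Category D
  open Functor F

  Full : Set (o ⊔ ℓ ⊔ ℓ′ ⊔ e′)
  Full = ∀ {A B} (h : F₀ A D.⇒ F₀ B) → Σ[ f ∈ A C.⇒ B ] F₁ f D.≈ h

  Faithful : Set (o ⊔ ℓ ⊔ e ⊔ e′)
  Faithful = ∀ {A B} {f g : A C.⇒ B} → F₁ f D.≈ F₁ g → f C.≈ g

  PreservesPullbacks : Set (o ⊔ ℓ ⊔ e ⊔ o′ ⊔ ℓ′ ⊔ e′)
  PreservesPullbacks =
    ∀ {A B E G} {f : A C.⇒ B} {m : A C.⇒ E} {n : B C.⇒ G} {g : E C.⇒ G} →
    IsPullback C f m n g → IsPullback D (F₁ f) (F₁ m) (F₁ n) (F₁ g)

  PreservesPushoutsOf : ∀ {p q} → ArrowClass C p → ArrowClass C q →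
                        Set (o ⊔ ℓ ⊔ e ⊔ o′ ⊔ ℓ′ ⊔ e′ ⊔ p ⊔ q)
  PreservesPushoutsOf ℳ 𝒩 =
    ∀ {A B E G} {m : A C.⇒ B} {n : A C.⇒ E} {i₁ : B C.⇒ G} {i₂ : E C.⇒ G} →
    m ∈ ℳ → n ∈ 𝒩 →
    IsPushout C m n i₁ i₂ → IsPushout D (F₁ m) (F₁ n) (F₁ i₁) (F₁ i₂)

-- κ is the universe level of the sets (setoids) in which
-- sheaves take their values; with κ ≥ o, ℓ, e the category C is small relative
-- to them.

module _ {o ℓ e} (C : Category o ℓ e) (κ : Level) where
  open Category C

  record Sieve (U : Obj) : Set (o ⊔ ℓ ⊔ e ⊔ suc κ) where
    field
      Arrow  : ∀ {V} → V ⇒ U → Set κ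
      resp-≈ : ∀ {V} {f g : V ⇒ U} → f ≈ g → Arrow f → Arrow g
      closed : ∀ {V W} {f : V ⇒ U} (g : W ⇒ V) → Arrow f → Arrow (f ∘ g)

  pullbackSieve : ∀ {U V} → V ⇒ U → Sieve U → Sieve V
  pullbackSieve h S = record
    { Arrow  = λ f → Arrow (h ∘ f)
    ; resp-≈ = λ eq → resp-≈ (∘-resp-≈ Equiv.refl eq)
    ; closed = λ g s → resp-≈ assoc (closed g s)
    }
    where open Sieve S

  -- Sieves are identified up to containing the same arrows, hence the field
  -- extensional; a sieve is maximal when it contains the identity.
  record GrothendieckTopology : Set (o ⊔ ℓ ⊔ e ⊔ suc κ) where
    field
      Covers      : ∀ {U} → Sieve U → Set κ
      extensional : ∀ {U} {S R : Sieve U} →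
                    (∀ {V} (f : V ⇒ U) → Sieve.Arrow S f ⇔ Sieve.Arrow R f) →
                    Covers S → Covers R
      maximal     : ∀ {U} {S : Sieve U} → Sieve.Arrow S id → Covers S
      stable      : ∀ {U V} {S : Sieve U} (h : V ⇒ U) →
                    Covers S → Covers (pullbackSieve h S)
      transitive  : ∀ {U} {S R : Sieve U} → Covers S →
                    (∀ {V} {f : V ⇒ U} → Sieve.Arrow S f → Covers (pullbackSieve f R)) →
                    Covers R

  Presheaf : Set (o ⊔ ℓ ⊔ e ⊔ suc κ)
  Presheaf = Functor (op C) (Setoids κ κ)

  module _ (P : Presheaf) where
    open Functor P
    private
      _≋_ : ∀ {U} → Setoid.Carrier (F₀ U) → Setoid.Carrier (F₀ U) → Set κ
      _≋_ {U} = Setoid._≈_ (F₀ U)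

    -- A section may not depend on the proof that its arrow lies in the sieve,
    -- nor distinguish ≈-equal arrows.
    record MatchingFamily {U} (S : Sieve U) : Set (o ⊔ ℓ ⊔ e ⊔ κ) where
      open Sieve S using (Arrow)
      field
        section  : ∀ {V} (f : V ⇒ U) → Arrow f → Setoid.Carrier (F₀ V)
        section-cong : ∀ {V} {f g : V ⇒ U} (s : Arrow f) (t : Arrow g) →
                       f ≈ g → section f s ≋ section g t
        matching : ∀ {V W} {f : V ⇒ U} (g : W ⇒ V) (s : Arrow f) (t : Arrow (f ∘ g)) →
                   to (F₁ g) (section f s) ≋ section (f ∘ g) t

    IsAmalgamation : ∀ {U} {S : Sieve U} → MatchingFamily S →
                     Setoid.Carrier (F₀ U) → Set (o ⊔ ℓ ⊔ κ)
    IsAmalgamation {U} {S} x z =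
      ∀ {V} {f : V ⇒ U} (s : Sieve.Arrow S f) → to (F₁ f) z ≋ MatchingFamily.section x f s

    IsSheaf : GrothendieckTopology → Set (o ⊔ ℓ ⊔ e ⊔ suc κ)
    IsSheaf J =
      ∀ {U} {S : Sieve U} → GrothendieckTopology.Covers J S → (x : MatchingFamily S) →
      Σ[ z ∈ Setoid.Carrier (F₀ U) ]
        (IsAmalgamation x z × (∀ {w} → IsAmalgamation x w → w ≋ z))

  record Sheaf (J : GrothendieckTopology) : Set (o ⊔ ℓ ⊔ e ⊔ suc κ) where
    field
      presheaf : Presheaf
      isSheaf  : IsSheaf presheaf J

module _ {o ℓ e κ : Level} {C : Category o ℓ e} where

  -- For κ ≥ o, ℓ, e this is a Grothendieck topos.  Its subobject classifier
  -- (closed sieves) lives one universe up, predicativity forbidding it here,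
  -- so toposes are taken to be categories of this form.
  Sh : GrothendieckTopology C κ →
       Category (o ⊔ ℓ ⊔ e ⊔ suc κ) (o ⊔ ℓ ⊔ κ) (o ⊔ κ)
  Sh J = record
    { Obj       = Sheaf C κ J
    ; _⇒_       = λ P Q → NaturalTransformation (presheaf P) (presheaf Q)
    ; _≈_       = λ α β → ∀ U → η α U ≈ₛ η β U
    ; id        = λ {P} → record
      { η       = λ U → Id.function (Functor.F₀ (presheaf P) U)
      ; commute = λ f x → Setoid.refl (Functor.F₀ (presheaf P) _)
      }
    ; _∘_       = λ {P} {Q} {R} β α → record
      { η       = λ U → Comp.function (η α U) (η β U)
      ; commute = λ {U} {V} f x → Setoid.trans (Functor.F₀ (presheaf R) V)
          (cong (η β V) (commute α f x)) (commute β f (to (η α U) x))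
      }
    ; assoc     = λ {_} {_} {_} {R} U x → Setoid.refl (Functor.F₀ (presheaf R) U)
    ; identityˡ = λ {_} {Q} U x → Setoid.refl (Functor.F₀ (presheaf Q) U)
    ; identityʳ = λ {_} {Q} U x → Setoid.refl (Functor.F₀ (presheaf Q) U)
    ; equiv     = λ {_} {Q} → record
      { refl  = λ U x → Setoid.refl (Functor.F₀ (presheaf Q) U)
      ; sym   = λ p U x → Setoid.sym (Functor.F₀ (presheaf Q) U) (p U x)
      ; trans = λ p q U x → Setoid.trans (Functor.F₀ (presheaf Q) U) (p U x) (q U x)
      }
    ; ∘-resp-≈  = λ {_} {_} {R} {_} {h} {g} {_} p q U x →
        Setoid.trans (Functor.F₀ (presheaf R) U) (p U (to (η g U) x)) (cong (η h U) (q U x))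
    }
    where
      open Sheaf
      open NaturalTransformation
      open Category (Setoids κ κ) using () renaming (_≈_ to _≈ₛ_)

{-# OPTIONS --safe #-}
-- The topology J is the canonical one and the functor is Yoneda, so only the
-- preservation of pushouts needs an argument.  For an ℳ,𝒩-pushout
-- i₁ : B ⇒ D ⇐ C : i₂ of m and n, the Van Kampen condition makes {i₁, i₂} a
-- universally effective epimorphic family, and the square is also a pullback
-- with i₂ mono.  For a sheaf P, sections b over B and c over C that agree over A
-- hence glue as soon as b agrees with itself on the kernel pair R of i₁.  This
-- is automatic: R is the union of the diagonal B and of the kernel pair U of n,
-- that is, the pushout K of B and U over A maps onto R.  The comparison K ⇒ R is
-- mono because K is covered by B and U, and then the Van Kampen condition for
-- the pullback of the original pushout along i₁ gives it a section.
module Submission where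

open import Defs
open import Level using (Level; _⊔_; Lift; lift; lower)
open import Data.Product using (Σ-syntax; _×_; _,_; proj₁; proj₂)
open import Function.Bundles using (Func; Equivalence)
open import Relation.Binary.Bundles using (Setoid)
import Relation.Binary.Reasoning.Setoid as SetoidReasoning

-- Equational reasoning in hom-setoids.

module Reasoning {o ℓ e : Level} (X : Category o ℓ e) where
  open Category X

  homSetoid : Obj → Obj → Setoid ℓ e
  homSetoid A B = record { isEquivalence = equiv {A} {B} }

  module _ {A B : Obj} where
    open SetoidReasoning (homSetoid A B) public

  infixr 4 refl⟩∘⟨_
  infixl 5 _⟩∘⟨refl

  refl⟩∘⟨_ : ∀ {A B C} {f : B ⇒ C} {g h : A ⇒ B} → g ≈ h → f ∘ g ≈ f ∘ h
  refl⟩∘⟨ p = ∘-resp-≈ Equiv.refl p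

  _⟩∘⟨refl : ∀ {A B C} {f g : B ⇒ C} {h : A ⇒ B} → f ≈ g → f ∘ h ≈ g ∘ h
  p ⟩∘⟨refl = ∘-resp-≈ p Equiv.refl

  pullˡ : ∀ {A B C D} {f : C ⇒ D} {g : B ⇒ C} {h : B ⇒ D} {k : A ⇒ B} →
          f ∘ g ≈ h → f ∘ (g ∘ k) ≈ h ∘ k
  pullˡ p = Equiv.trans (Equiv.sym assoc) (p ⟩∘⟨refl)

  pullʳ : ∀ {A B C D} {f : C ⇒ D} {g : B ⇒ C} {k : A ⇒ B} {h : A ⇒ C} →
          g ∘ k ≈ h → (f ∘ g) ∘ k ≈ f ∘ h
  pullʳ p = Equiv.trans assoc (refl⟩∘⟨ p)

  cancelˡ : ∀ {A B C} {f : B ⇒ C} {g : C ⇒ B} {h : A ⇒ C} →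
            f ∘ g ≈ id → f ∘ (g ∘ h) ≈ h
  cancelˡ p = Equiv.trans (pullˡ p) identityˡ

  cancelʳ : ∀ {A B C} {f : B ⇒ C} {g : A ⇒ B} {h : B ⇒ A} →
            g ∘ h ≈ id → (f ∘ g) ∘ h ≈ f
  cancelʳ p = Equiv.trans (pullʳ p) identityʳ

-- Pasting, cancellation and degenerate cases of pullback and pushout squares.

module Squares {o ℓ e : Level} (X : Category o ℓ e) where
  open Category X
  open Reasoning X
  open IsPullback

  pullback-jointly-monic : ∀ {A B C D} {f : A ⇒ B} {m : A ⇒ C} {n : B ⇒ D} {g : C ⇒ D} →
    IsPullback X f m n g → ∀ {Z} {u v : Z ⇒ A} → f ∘ u ≈ f ∘ v → m ∘ u ≈ m ∘ v → u ≈ v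
  pullback-jointly-monic pb {u = u} {v} p q =
    Equiv.trans (unique pb {eq = eq} p q) (Equiv.sym (unique pb Equiv.refl Equiv.refl))
    where
    eq = begin
      _ ≈⟨ pullˡ (commute pb) ⟩
      _ ≈⟨ assoc ⟩
      _ ∎

  pushout-jointly-epic : ∀ {A B C D} {f : A ⇒ B} {m : A ⇒ C} {n : B ⇒ D} {g : C ⇒ D} →
    IsPushout X f m n g → ∀ {Z} {u v : D ⇒ Z} → u ∘ n ≈ v ∘ n → u ∘ g ≈ v ∘ g → u ≈ v
  pushout-jointly-epic po {u = u} {v} p q =
    Equiv.trans (PO.unique {eq = eq} p q) (Equiv.sym (PO.unique Equiv.refl Equiv.refl))
    where
    module PO = IsPushout po
    eq = begin
      _ ≈⟨ pullʳ PO.commute ⟩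
      _ ≈⟨ Equiv.sym assoc ⟩
      _ ∎

  pullback-paste : ∀ {A B C D E F} {f : A ⇒ B} {m : A ⇒ C} {n : B ⇒ D} {g : C ⇒ D}
    {h : B ⇒ E} {r : E ⇒ F} {k : D ⇒ F} →
    IsPullback X f m n g → IsPullback X h n r k → IsPullback X (h ∘ f) m r (k ∘ g)
  pullback-paste {f = f} {m} {n} {g} {h} {r} {k} left right = record
    { commute = begin
        r ∘ (h ∘ f) ≈⟨ pullˡ R.commute ⟩
        (k ∘ n) ∘ f ≈⟨ pullʳ L.commute ⟩
        k ∘ (g ∘ m) ≈⟨ Equiv.sym assoc ⟩
        (k ∘ g) ∘ m ∎
    ; universal = λ eq → L.universal (R.m∘universal≈k {eq = Equiv.trans eq assoc})
    ; f∘universal≈h = Equiv.trans (pullʳ L.f∘universal≈h) R.f∘universal≈h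
    ; m∘universal≈k = L.m∘universal≈k
    ; unique = λ p q → L.unique
        (R.unique (Equiv.trans (Equiv.sym assoc) p)
                  (Equiv.trans (pullˡ L.commute) (pullʳ q)))
        q
    }
    where
    module L = IsPullback left
    module R = IsPullback right

  pullback-cancel : ∀ {A B C D E F} {f : A ⇒ B} {m : A ⇒ C} {n : B ⇒ D} {g : C ⇒ D}
    {h : B ⇒ E} {r : E ⇒ F} {k : D ⇒ F} →
    n ∘ f ≈ g ∘ m → IsPullback X h n r k → IsPullback X (h ∘ f) m r (k ∘ g) →
    IsPullback X f m n g
  pullback-cancel {f = f} {m} {n} {g} {h} {r} {k} comm right outer = record
    { commute = comm
    ; universal = λ eq → O.universal (lemma eq)
    ; f∘universal≈h = λ {_} {_} {_} {eq} → pullback-jointly-monic right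
        (Equiv.trans (Equiv.sym assoc) O.f∘universal≈h)
        (begin
          _ ≈⟨ pullˡ comm ⟩
          _ ≈⟨ pullʳ O.m∘universal≈k ⟩
          _ ≈⟨ Equiv.sym eq ⟩
          _ ∎)
    ; m∘universal≈k = O.m∘universal≈k
    ; unique = λ p q → O.unique (pullʳ p) q
    }
    where
    module O = IsPullback outer
    module R = IsPullback right
    lemma : ∀ {Z} {u : Z ⇒ _} {v : Z ⇒ _} → n ∘ u ≈ g ∘ v → r ∘ (h ∘ u) ≈ (k ∘ g) ∘ v
    lemma eq = begin
      _ ≈⟨ pullˡ R.commute ⟩
      _ ≈⟨ pullʳ eq ⟩
      _ ≈⟨ Equiv.sym assoc ⟩
      _ ∎

  pullback-resp-≈ : ∀ {A B C D} {f f′ : A ⇒ B} {m : A ⇒ C} {n : B ⇒ D} {g g′ : C ⇒ D} →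
    f ≈ f′ → g ≈ g′ → IsPullback X f m n g → IsPullback X f′ m n g′
  pullback-resp-≈ p q pb = record
    { commute = begin
        _ ≈⟨ refl⟩∘⟨ Equiv.sym p ⟩
        _ ≈⟨ PB.commute ⟩
        _ ≈⟨ q ⟩∘⟨refl ⟩
        _ ∎
    ; universal = λ eq → PB.universal (Equiv.trans eq (Equiv.sym q ⟩∘⟨refl))
    ; f∘universal≈h = Equiv.trans (Equiv.sym p ⟩∘⟨refl) PB.f∘universal≈h
    ; m∘universal≈k = PB.m∘universal≈k
    ; unique = λ r s → PB.unique (Equiv.trans (p ⟩∘⟨refl) r) s
    }
    where module PB = IsPullback pb

  -- For a competing pair `(h , v)` one has `k ∘ h ≈ g ∘ v ≈ k ∘ (f ∘ v)`, so cancelling `k` leaves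
  -- `v` as the only choice. Such squares supply back faces of Van Kampen cubes whose edge `a` is an
  -- identity.
  mono-factor-pullback : ∀ {A B C} {f : A ⇒ B} {k : B ⇒ C} {g : A ⇒ C} →
    IsMono X k → k ∘ f ≈ g → IsPullback X f id k g
  mono-factor-pullback mono p = record
    { commute = Equiv.trans p (Equiv.sym identityʳ)
    ; universal = λ {_} {_} {v} _ → v
    ; f∘universal≈h = λ {_} {_} {_} {eq} → mono (Equiv.trans (pullˡ p) (Equiv.sym eq))
    ; m∘universal≈k = identityˡ
    ; unique = λ _ q → Equiv.trans (Equiv.sym identityˡ) q
    }

  id-pullback : ∀ {A B} (f : A ⇒ B) → IsPullback X f id id f
  id-pullback f = mono-factor-pullback
    (λ eq → Equiv.trans (Equiv.sym identityˡ) (Equiv.trans eq identityˡ)) identityˡ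

  id-pushout : ∀ {A B} (f : A ⇒ B) → IsPushout X id f f id
  id-pushout f = record
    { commute = Equiv.trans identityʳ (Equiv.sym identityˡ)
    ; universal = λ {_} {_} {k} _ → k
    ; universal∘n≈h = λ {_} {_} {_} {eq} → Equiv.trans (Equiv.sym eq) identityʳ
    ; universal∘g≈k = identityʳ
    ; unique = λ _ q → Equiv.trans (Equiv.sym identityʳ) q
    }

  pullback-transpose : ∀ {A B C D} {f : A ⇒ B} {m : A ⇒ C} {n : B ⇒ D} {g : C ⇒ D} →
    IsPullback X f m n g → IsPullback X m f g n
  pullback-transpose pb = record
    { commute       = Equiv.sym PB.commute
    ; universal     = λ eq → PB.universal (Equiv.sym eq)
    ; f∘universal≈h = PB.m∘universal≈k
    ; m∘universal≈k = PB.f∘universal≈h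
    ; unique        = λ p q → PB.unique q p
    }
    where module PB = IsPullback pb

  pushout-transpose : ∀ {A B C D} {f : A ⇒ B} {m : A ⇒ C} {n : B ⇒ D} {g : C ⇒ D} →
    IsPushout X f m n g → IsPushout X m f g n
  pushout-transpose po = record
    { commute       = Equiv.sym PO.commute
    ; universal     = λ eq → PO.universal (Equiv.sym eq)
    ; universal∘n≈h = PO.universal∘g≈k
    ; universal∘g≈k = PO.universal∘n≈h
    ; unique        = λ p q → PO.unique q p
    }
    where module PO = IsPushout po

-- Sheaf condition for a single sieve

module SheafCondition {o ℓ e : Level} (C : Category o ℓ e) (κ : Level) where
  open Category C
  open Sieve
  open MatchingFamily
  open Func using (to; cong)

  infix 4 _⊆_ _≐_

  _⊆_ : ∀ {U} → Sieve C κ U → Sieve C κ U → Set (o ⊔ ℓ ⊔ κ)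
  R ⊆ S = ∀ {V} {f : V ⇒ _} → Arrow R f → Arrow S f

  _≐_ : ∀ {U} → Sieve C κ U → Sieve C κ U → Set (o ⊔ ℓ ⊔ κ)
  R ≐ S = (R ⊆ S) × (S ⊆ R)

  module _ (P : Presheaf C κ) where
    open Functor P

    private
      module P {U} = Setoid (F₀ U)

    infixl 7 _·_
    infix 4 _≋_

    _·_ : ∀ {U V} → P.Carrier {U} → V ⇒ U → P.Carrier {V}
    z · f = to (F₁ f) z

    _≋_ : ∀ {U} → P.Carrier {U} → P.Carrier {U} → Set κ
    _≋_ = P._≈_

    restrict : ∀ {U} {R S : Sieve C κ U} → R ⊆ S → MatchingFamily C κ P S →
               MatchingFamily C κ P R
    restrict inc x = record
      { section      = λ f s → section x f (inc s)
      ; section-cong = λ s t p → section-cong x (inc s) (inc t) p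
      ; matching     = λ g s t → matching x g (inc s) (inc t)
      }

    section-factor : ∀ {U} {S : Sieve C κ U} (x : MatchingFamily C κ P S)
      {V W} {f : V ⇒ U} {g : W ⇒ V} {h : W ⇒ U} (s : Arrow S f) (t : Arrow S h) →
      f ∘ g ≈ h → section x f s · g ≋ section x h t
    section-factor {S = S} x {g = g} s t p =
      P.trans (matching x g s (closed S g s)) (section-cong x _ t p)

    pull : ∀ {U V} {S : Sieve C κ U} (h : V ⇒ U) → MatchingFamily C κ P S →
           MatchingFamily C κ P (pullbackSieve C κ h S)
    pull h x = record
      { section      = λ f s → section x (h ∘ f) s
      ; section-cong = λ s t p → section-cong x s t (∘-resp-≈ Equiv.refl p)
      ; matching     = λ g s t → section-factor x s t assoc
      }

    family : ∀ {U} (S : Sieve C κ U) → P.Carrier {U} → MatchingFamily C κ P S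
    family S z = record
      { section      = λ f _ → z · f
      ; section-cong = λ _ _ p → F-resp-≈ p z
      ; matching     = λ g _ _ → P.sym (homomorphism z)
      }

    IsSheafFor : ∀ {U} → Sieve C κ U → Set (o ⊔ ℓ ⊔ e ⊔ κ)
    IsSheafFor {U} S = (x : MatchingFamily C κ P S) →
      Σ[ z ∈ P.Carrier {U} ]
        (IsAmalgamation C κ P x z × (∀ {w} → IsAmalgamation C κ P x w → w ≋ z))

    -- Both sections amalgamate `family S w`, and amalgamations are unique.
    separated : ∀ {U} {S : Sieve C κ U} → IsSheafFor S → ∀ {z w : P.Carrier {U}} →
                (∀ {V} {f : V ⇒ U} → Arrow S f → z · f ≋ w · f) → z ≋ w
    separated {S = S} sheaf {z} {w} agree =
      let _ , _ , unique = sheaf (family S w)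
      in P.trans (unique agree) (P.sym (unique (λ _ → P.refl)))

    IsSheafFor-resp : ∀ {U} {R S : Sieve C κ U} → R ≐ S → IsSheafFor R → IsSheafFor S
    IsSheafFor-resp {R = R} (R⊆S , S⊆R) sheaf x =
      let z , amalgamates , unique = sheaf (restrict R⊆S x)
      in z
       , (λ s → P.trans (amalgamates (S⊆R s)) (section-cong x _ s Equiv.refl))
       , (λ p → unique (λ r → p (R⊆S r)))

    -- The sheaf condition for one sieve need not survive pullback; quantifying over `h` builds in
    -- the stability that a topology demands.
    UniversallySheafFor : ∀ {U} → Sieve C κ U → Set (o ⊔ ℓ ⊔ e ⊔ κ)
    UniversallySheafFor {U} S =
      ∀ {V} (h : V ⇒ U) → IsSheafFor (pullbackSieve C κ h S)

  pullbackSieve-id : ∀ {U} (S : Sieve C κ U) → pullbackSieve C κ id S ≐ S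
  pullbackSieve-id S = resp-≈ S identityˡ , resp-≈ S (Equiv.sym identityˡ)

  pullbackSieve-∘ : ∀ {U V W} (S : Sieve C κ U) (h : V ⇒ U) (g : W ⇒ V) →
    pullbackSieve C κ (h ∘ g) S ≐ pullbackSieve C κ g (pullbackSieve C κ h S)
  pullbackSieve-∘ S h g = resp-≈ S assoc , resp-≈ S (Equiv.sym assoc)

  pullbackSieve-≐ : ∀ {U V} {R S : Sieve C κ U} (h : V ⇒ U) → R ≐ S →
    pullbackSieve C κ h R ≐ pullbackSieve C κ h S
  pullbackSieve-≐ h (p , q) = p , q

  -- The topology axioms for the universal sheaf condition.

  module _ (P : Presheaf C κ) where
    open Functor P
    private
      module P {U} = Setoid (F₀ U)

    universally⇒sheafFor : ∀ {U} {S : Sieve C κ U} →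
      UniversallySheafFor P S → IsSheafFor P S
    universally⇒sheafFor {S = S} sheaf = IsSheafFor-resp P (pullbackSieve-id S) (sheaf id)

    universally-maximal : ∀ {U} {S : Sieve C κ U} → Arrow S id → UniversallySheafFor P S
    universally-maximal {S = S} s h x =
      section x id total
      , (λ t → section-factor P x total t identityˡ)
      , (λ p → P.trans (P.sym (identity _)) (p total))
      where
      total : Arrow S (h ∘ id)
      total = resp-≈ S (Equiv.trans identityˡ (Equiv.sym identityʳ)) (closed S h s)

    universally-stable : ∀ {U V} {S : Sieve C κ U} (h : V ⇒ U) →
      UniversallySheafFor P S → UniversallySheafFor P (pullbackSieve C κ h S)
    universally-stable {S = S} h sheaf g =
      IsSheafFor-resp P (pullbackSieve-∘ S h g) (sheaf (h ∘ g))

    -- Gluing in two stages: over each arrow of the pulled-back `S` the family is amalgamated along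
    -- the pullback of `R`; the resulting pieces, compatible by uniqueness, are then amalgamated
    -- along `S`.
    universally-transitive : ∀ {U} {S R : Sieve C κ U} → UniversallySheafFor P S →
      (∀ {V} {f : V ⇒ U} → Arrow S f → UniversallySheafFor P (pullbackSieve C κ f R)) →
      UniversallySheafFor P R
    universally-transitive {U} {S} {R} sheafS sheafR {V} h x =
      proj₁ glued , amalgamates , unique
      where
      local : ∀ {W} (f : W ⇒ V) → Arrow S (h ∘ f) →
              IsSheafFor P (pullbackSieve C κ f (pullbackSieve C κ h R))
      local f s = IsSheafFor-resp P (pullbackSieve-∘ R h f) 
        (universally⇒sheafFor {S = pullbackSieve C κ (h ∘ f) R} (sheafR s))

      piece : ∀ {W} (f : W ⇒ V) → Arrow S (h ∘ f) → P.Carrier {W}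
      piece f s = proj₁ (local f s (pull P f x))

      piece-section : ∀ {W} {f : W ⇒ V} (s : Arrow S (h ∘ f)) {T} {g : T ⇒ W}
        (r : Arrow R (h ∘ (f ∘ g))) → P._≈_ (to (F₁ g) (piece f s)) (section x (f ∘ g) r)
      piece-section {f = f} s r = proj₁ (proj₂ (local f s (pull P f x))) r

      piece-factor : ∀ {W T} {f : W ⇒ V} {k : T ⇒ V} (g : T ⇒ W)
        (s : Arrow S (h ∘ f)) (t : Arrow S (h ∘ k)) → f ∘ g ≈ k →
        P._≈_ (to (F₁ g) (piece f s)) (piece k t)
      piece-factor {f = f} {k} g s t p =
        -- Uniqueness over `k` reduces the claim to arrows of the pulled-back `R`, where both sides
        -- are sections of `x`.
        proj₂ (proj₂ (local k t (pull P k x))) λ {_} {j} r →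
          let eq = Equiv.trans (Equiv.sym assoc) (∘-resp-≈ p Equiv.refl)
              r′ = resp-≈ R (∘-resp-≈ Equiv.refl (Equiv.sym eq)) r
          in P.trans (P.sym (homomorphism (piece f s)))
               (P.trans (piece-section s r′) (section-cong x r′ r eq))

      pieces : MatchingFamily C κ P (pullbackSieve C κ h S)
      pieces = record
        { section      = piece
        ; section-cong = λ {_} {f} s t p →
            P.trans (P.sym (identity (piece f s)))
              (piece-factor id s t (Equiv.trans identityʳ p))
        ; matching     = λ g s t → piece-factor g s t Equiv.refl
        }

      glued = sheafS h pieces

      amalgamates : IsAmalgamation C κ P x (proj₁ glued)
      amalgamates {W} {g} r =
        -- Equality over `g` is tested on the pullback of `S`: after a further `k` with
        -- `h ∘ (g ∘ k)` in `S`, the glued section becomes the piece at `g ∘ k`.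
        separated P {S = pullbackSieve C κ g (pullbackSieve C κ h S)}
          (IsSheafFor-resp P (pullbackSieve-∘ S h g) (sheafS (h ∘ g)))
          λ {T} {k} s →
            let r₁ = resp-≈ R assoc (closed R k r)
                -- `piece-section` describes restrictions of a piece, so the piece itself is read
                -- off at `id`.
                r₂ = resp-≈ R (∘-resp-≈ Equiv.refl (Equiv.sym identityʳ)) r₁
            in P.trans (P.sym (homomorphism (proj₁ glued)))
               (P.trans (proj₁ (proj₂ glued) s)
               (P.trans (P.sym (identity (piece (g ∘ k) s)))
               (P.trans (piece-section s r₂)
               (P.trans (section-cong x r₂ r₁ identityʳ)
                        (P.sym (matching x k r r₁))))))

      unique : ∀ {w} → IsAmalgamation C κ P x w → P._≈_ w (proj₁ glued)
      unique {w} p = proj₂ (proj₂ glued) λ {W} {f} s →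
        proj₂ (proj₂ (local f s (pull P f x))) λ r →
          P.trans (P.sym (homomorphism w)) (p r)

-- The canonical topology and the Yoneda embedding

module Canonical {o ℓ e : Level} (X : Category o ℓ e) where
  κ : Level
  κ = o ⊔ ℓ ⊔ e

  open Category X
  open Reasoning X
  open SheafCondition X κ public
  open Func using (to)

  representable : Obj → Presheaf X κ
  representable W = record
    { F₀ = λ V → record
      { Carrier = Lift κ (V ⇒ W)
      ; _≈_     = λ f g → Lift κ (lower f ≈ lower g)
      ; isEquivalence = record
        { refl  = lift Equiv.refl
        ; sym   = λ p → lift (Equiv.sym (lower p))
        ; trans = λ p q → lift (Equiv.trans (lower p) (lower q))
        }
      }
    ; F₁ = λ g → record
      { to   = λ f → lift (lower f ∘ g)
      ; cong = λ p → lift (lower p ⟩∘⟨refl)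
      }
    ; identity     = λ _ → lift identityʳ
    ; homomorphism = λ _ → lift (Equiv.sym assoc)
    ; F-resp-≈     = λ p _ → lift (refl⟩∘⟨ p)
    }

  -- The largest topology for which every representable is a sheaf. Testing only against
  -- representables, which are indexed by objects, keeps `Covers` in the universe `κ`.
  canonical : GrothendieckTopology X κ
  canonical = record
    { Covers      = λ S → ∀ W → UniversallySheafFor (representable W) S
    ; extensional = λ {_} {S} {R} S⇔R cover W h →
        IsSheafFor-resp (representable W)
          (pullbackSieve-≐ {R = S} {S = R} h
            ((λ {_} {f} → Equivalence.to (S⇔R f)) , (λ {_} {f} → Equivalence.from (S⇔R f))))
          (cover W h)
    ; maximal     = λ {_} {S} s W → universally-maximal (representable W) {S = S} s
    ; stable      = λ {_} {_} {S} h cover W →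
        universally-stable (representable W) {S = S} h (cover W)
    ; transitive  = λ {_} {S} {R} cover covers W →
        universally-transitive (representable W) {S = S} {R = R} (cover W) (λ s → covers s W)
    }

  open GrothendieckTopology canonical using (Covers)

  -- Arrows `V ⇒ W` are sections over `V` of a representable, and this is separated for the covering
  -- sieve pulled back along `h`.
  covering-separates : ∀ {U} {S : Sieve X κ U} → Covers S →
    ∀ {V W} (h : V ⇒ U) {f g : V ⇒ W} →
    (∀ {T} (t : T ⇒ V) → Sieve.Arrow S (h ∘ t) → f ∘ t ≈ g ∘ t) → f ≈ g
  covering-separates {S = S} cover {W = W} h agree = lower
    (separated (representable W) {S = pullbackSieve X κ h S} (cover W h)
      (λ {_} {t} s → lift (agree t s)))

  yoneda : Functor X (Sh canonical)
  yoneda = record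
    { F₀ = λ W → record
      { presheaf = representable W
      ; isSheaf  = λ {_} {S} cover → universally⇒sheafFor (representable W) {S = S} (cover W)
      }
    ; F₁ = λ f → record
      { η = λ V → record
        { to   = λ u → lift (f ∘ lower u)
        ; cong = λ p → lift (refl⟩∘⟨ lower p)
        }
      ; commute = λ _ _ → lift (Equiv.sym assoc)
      }
    ; identity     = λ _ _ → lift identityˡ
    ; homomorphism = λ _ _ → lift assoc
    ; F-resp-≈     = λ p _ _ → lift (p ⟩∘⟨refl)
    }

  open NaturalTransformation

  module _ {P : Presheaf X κ} where
    open Functor P
    private
      module P {U} = Setoid (F₀ U)

    element : ∀ {W} → NaturalTransformation (representable W) P → P.Carrier {W}
    element α = to (η α _) (lift id)

    -- Yoneda's lemma: naturality at `id` makes the element determine the transformation.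
    element-· : ∀ {W} (α : NaturalTransformation (representable W) P) {V} (u : V ⇒ W) →
                to (η α V) (lift u) P.≈ to (F₁ u) (element α)
    element-· α u = P.trans (Func.cong (η α _) (lift (Equiv.sym identityˡ)))
                            (commute α u (lift id))

    fromElement : ∀ {W} → P.Carrier {W} → NaturalTransformation (representable W) P
    fromElement z = record
      { η = λ V → record
        { to   = λ u → to (F₁ (lower u)) z
        ; cong = λ p → F-resp-≈ (lower p) z
        }
      ; commute = λ g u → homomorphism z
      }

  yoneda-full : Full yoneda
  yoneda-full {B = B} α = lower (element α) , λ V u →
    Setoid.sym (Functor.F₀ (representable B) V) (element-· α (lower u))

  yoneda-faithful : Faithful yoneda
  yoneda-faithful {A} p =
    Equiv.trans (Equiv.sym identityʳ) (Equiv.trans (lower (p A (lift id))) identityʳ)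

  -- The universal transformation is formed at each stage from the pullback in `X`; uniqueness there
  -- makes it respect equality and restriction.
  yoneda-preservesPullbacks : PreservesPullbacks yoneda
  yoneda-preservesPullbacks pb = record
    { commute   = λ V u → lift (Equiv.trans (pullˡ PB.commute) assoc)
    ; universal = λ {_} {h} {k} eq → record
      { η = λ V → record
        { to   = λ z → lift (PB.universal (lower (eq V z)))
        ; cong = λ p → lift (PB.unique
            (Equiv.trans PB.f∘universal≈h (lower (Func.cong (η h V) p)))
            (Equiv.trans PB.m∘universal≈k (lower (Func.cong (η k V) p))))
        }
      ; commute = λ {V} {W} g z → lift (Equiv.sym (PB.unique
          (Equiv.trans (pullˡ PB.f∘universal≈h) (Equiv.sym (lower (commute h g z))))
          (Equiv.trans (pullˡ PB.m∘universal≈k) (Equiv.sym (lower (commute k g z))))))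
      }
    ; f∘universal≈h = λ V z → lift PB.f∘universal≈h
    ; m∘universal≈k = λ V z → lift PB.m∘universal≈k
    ; unique = λ p q V z → lift (PB.unique (lower (p V z)) (lower (q V z)))
    }
    where module PB = IsPullback pb

  -- An inhabitant carries a chosen factorisation, so that sections can be defined by cases on it.
  -- An arrow may factor in several ways, so independence of the choice has to be proved separately.
  data Factors {B C D V} (i₁ : B ⇒ D) (i₂ : C ⇒ D) (f : V ⇒ D) : Set κ where
    via₁ : (u : V ⇒ B) → f ≈ i₁ ∘ u → Factors i₁ i₂ f
    via₂ : (v : V ⇒ C) → f ≈ i₂ ∘ v → Factors i₁ i₂ f

  generated : ∀ {B C D} → B ⇒ D → C ⇒ D → Sieve X κ D
  generated i₁ i₂ = record
    { Arrow  = Factors i₁ i₂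
    ; resp-≈ = λ where
        p (via₁ u q) → via₁ u (Equiv.trans (Equiv.sym p) q)
        p (via₂ v q) → via₂ v (Equiv.trans (Equiv.sym p) q)
    ; closed = λ where
        g (via₁ u q) → via₁ (u ∘ g) (Equiv.trans (q ⟩∘⟨refl) assoc)
        g (via₂ v q) → via₂ (v ∘ g) (Equiv.trans (q ⟩∘⟨refl) assoc)
    }

-- Van Kampen pushouts as canonical covers.

module Adhesive {o ℓ e p q : Level} (X : Category o ℓ e) (ℳ : ArrowClass X p) (𝒩 : ArrowClass X q)
                (adhesive : IsAdhesive X ℳ 𝒩) (hasPullbacks : HasPullbacks X)
                (splitMonos : ContainSplitMonos X ℳ 𝒩) where
  open Category X
  open Reasoning X
  open Squares X
  open Canonical X
  open IsAdhesive adhesive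
  open IsPreadhesive preadhesive
  open GrothendieckTopology canonical using (Covers)
  open MatchingFamily
  open Func using (to; cong)

  -- What completes a cube over the span of `m` and `n` once its two front faces are given: the back
  -- faces and the pushout on top.
  record PulledBackSquare {A B C V P₁ P₂}
      (m : A ⇒ B) (n : A ⇒ C) (n′ : P₁ ⇒ V) (b : P₁ ⇒ B) (f′ : P₂ ⇒ V) (c : P₂ ⇒ C)
      : Set (o ⊔ ℓ ⊔ e) where
    field
      {P₀} : Obj
      g′ : P₀ ⇒ P₁
      m′ : P₀ ⇒ P₂
      a  : P₀ ⇒ A
      pullback₁ : IsPullback X g′ a b m
      pullback₂ : IsPullback X m′ a c n
      pushout   : IsPushout X g′ m′ n′ f′

  module _ {A B C D : Obj} {m : A ⇒ B} {n : A ⇒ C} {i₁ : B ⇒ D} {i₂ : C ⇒ D}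
           (m∈ℳ : m ∈ ℳ) (n∈𝒩 : n ∈ 𝒩) (po : IsPushout X m n i₁ i₂) where
    private
      module PO = IsPushout po

    i₂-mono : IsMono X i₂
    i₂-mono = ℳ-mono (ℳ-pushouts (pushout-transpose po) m∈ℳ)

    -- Van Kampen cube with `d = i₂` and the trivial pushout `id-pushout n` on top. One back face is
    -- a pullback because `m` is monic, the other trivially; the front face over `i₁` is the given
    -- square, transposed.
    pushout-isPullback : IsPullback X m n i₁ i₂
    pushout-isPullback = pullback-transpose (proj₁ (Equivalence.to
      (vanKampen m∈ℳ n∈𝒩 po id n n id id m id i₂
        (Equiv.trans identityʳ (Equiv.sym identityˡ)) (Equiv.sym PO.commute)
        Equiv.refl
        (mono-factor-pullback (ℳ-mono m∈ℳ) identityʳ) (id-pullback n))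
      (id-pushout n)))

    -- The back face over `m` is a chosen pullback. Pasting it to the front face over `i₁` and
    -- cancelling the front face over `i₂` gives the back face over `n`, and the Van Kampen
    -- condition then makes the top a pushout.
    pullBackSquare : ∀ {V P₁ P₂} {h : V ⇒ D}
      {n′ : P₁ ⇒ V} {b : P₁ ⇒ B} {f′ : P₂ ⇒ V} {c : P₂ ⇒ C} →
      IsPullback X n′ b h i₁ → IsPullback X f′ c h i₂ → PulledBackSquare m n n′ b f′ c
    pullBackSquare {h = h} {n′} {b} {f′} {c} pb₁ pb₂ = record
      { g′ = g′ ; m′ = m′ ; a = a
      ; pullback₁ = isPullback
      ; pullback₂ = back
      ; pushout   = Equivalence.from
          (vanKampen m∈ℳ n∈𝒩 po g′ m′ n′ f′ a b c h
            (Equiv.sym F₂.f∘universal≈h) F₁.commute F₂.commute isPullback back)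
          (pb₁ , pb₂)
      }
      where
      open Pullback (hasPullbacks b m) renaming (p₁ to g′; p₂ to a)
      module F₁ = IsPullback pb₁
      module F₂ = IsPullback pb₂
      pasted = pullback-paste isPullback pb₁
      m′ = F₂.universal (Equiv.trans (IsPullback.commute pasted)
             (Equiv.trans (PO.commute ⟩∘⟨refl) assoc))
      back : IsPullback X m′ a c n
      back = pullback-cancel F₂.m∘universal≈k pb₂
        (pullback-resp-≈ (Equiv.sym F₂.f∘universal≈h) PO.commute pasted)

    -- Pulling the square back along `h` yields a pushout with vertex `V`. A matching family with
    -- values in `W` restricts to a cocone under its span, and the induced arrow is the
    -- amalgamation.
    coprojections-cover : Covers (generated i₁ i₂)
    coprojections-cover W {V} h x =
      lift z , (λ s → lift (amalgamates s)) , λ p → lift (Z.unique (lower (p s₁)) (lower (p s₂)))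
      where
      module P₁ = Pullback (hasPullbacks h i₁)
      module P₂ = Pullback (hasPullbacks h i₂)
      module Q₁ = IsPullback P₁.isPullback
      module Q₂ = IsPullback P₂.isPullback
      open PulledBackSquare (pullBackSquare P₁.isPullback P₂.isPullback)
      module Z = IsPushout pushout

      s₁ : Factors i₁ i₂ (h ∘ P₁.p₁)
      s₁ = via₁ P₁.p₂ Q₁.commute
      s₂ : Factors i₁ i₂ (h ∘ P₂.p₁)
      s₂ = via₂ P₂.p₂ Q₂.commute

      factor : ∀ {U T} {f : U ⇒ V} {g : T ⇒ U} {k : T ⇒ V}
               (s : Factors i₁ i₂ (h ∘ f)) (t : Factors i₁ i₂ (h ∘ k)) → f ∘ g ≈ k →
               lower (section x f s) ∘ g ≈ lower (section x k t)
      factor s t p = lower (section-factor (representable W) x s t p)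

      agree : lower (section x P₁.p₁ s₁) ∘ g′ ≈ lower (section x P₂.p₁ s₂) ∘ m′
      agree = Equiv.trans (factor s₁ s₀ Z.commute) (Equiv.sym (factor s₂ s₀ Equiv.refl))
        where s₀ = Sieve.resp-≈ (generated i₁ i₂) assoc (Sieve.closed (generated i₁ i₂) m′ s₂)

      z = Z.universal agree

      amalgamates : ∀ {U} {f : U ⇒ V} (s : Factors i₁ i₂ (h ∘ f)) →
                    z ∘ f ≈ lower (section x f s)
      -- The factorisation of `h ∘ f` through `i₁` makes `f` factor through `P₁`, where `z` is
      -- known.
      amalgamates {f = f} s@(via₁ u eq) = begin
        z ∘ f                                              ≈⟨ refl⟩∘⟨ Equiv.sym Q₁.f∘universal≈h ⟩
        z ∘ (P₁.p₁ ∘ Q₁.universal eq)                      ≈⟨ pullˡ Z.universal∘n≈h ⟩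
        lower (section x P₁.p₁ s₁) ∘ Q₁.universal eq       ≈⟨ factor s₁ s Q₁.f∘universal≈h ⟩
        lower (section x f s)                              ∎
      amalgamates {f = f} s@(via₂ v eq) = begin
        z ∘ f                                              ≈⟨ refl⟩∘⟨ Equiv.sym Q₂.f∘universal≈h ⟩
        z ∘ (P₂.p₁ ∘ Q₂.universal eq)                      ≈⟨ pullˡ Z.universal∘g≈k ⟩
        lower (section x P₂.p₁ s₂) ∘ Q₂.universal eq       ≈⟨ factor s₂ s Q₂.f∘universal≈h ⟩
        lower (section x f s)                              ∎

  module _ {A B C D : Obj} {m : A ⇒ B} {n : A ⇒ C} {i₁ : B ⇒ D} {i₂ : C ⇒ D}
           (m∈ℳ : m ∈ ℳ) (n∈𝒩 : n ∈ 𝒩) (po : IsPushout X m n i₁ i₂) where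

    -- The kernel pair of a coprojection as a union.

    module KernelPair {R : Obj} {q₁ q₂ : R ⇒ B} (kernelPair : IsPullback X q₁ q₂ i₁ i₁) where
      private
        module R = IsPullback kernelPair
        m-mono : IsMono X m
        m-mono = ℳ-mono m∈ℳ

      -- U is the kernel pair (a₁, a₂) of n, and m̃ : U ⇒ R is induced by m.
      open PulledBackSquare (pullBackSquare m∈ℳ n∈𝒩 po kernelPair (pushout-isPullback m∈ℳ n∈𝒩 po))
        using () renaming
          ( P₀ to U; g′ to m̃; m′ to a₁; a to a₂
          ; pullback₁ to m̃-pullback; pullback₂ to a-kernelPair; pushout to top) public
      private
        module M̃ = IsPullback m̃-pullback
        module T = IsPushout top

      m̃∈ℳ : m̃ ∈ ℳ
      m̃∈ℳ = ℳ-pullbacks (pullback-transpose m̃-pullback) m∈ℳ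

      m̃-mono : IsMono X m̃
      m̃-mono = ℳ-mono m̃∈ℳ

      a₁∈𝒩 : a₁ ∈ 𝒩
      a₁∈𝒩 = 𝒩-pullbacks (pullback-transpose a-kernelPair) n∈𝒩

      δ : B ⇒ R
      δ = R.universal {h = id} {k = id} Equiv.refl

      q₁δ≈id : q₁ ∘ δ ≈ id
      q₁δ≈id = R.f∘universal≈h

      q₂δ≈id : q₂ ∘ δ ≈ id
      q₂δ≈id = R.m∘universal≈k

      -- The diagonal of the kernel pair `U`: its second leg is `id` by construction, its first by
      -- `a₁s≈id`.
      s : A ⇒ U
      s = M̃.universal {h = δ ∘ m} {k = id}
            (Equiv.trans (cancelˡ q₂δ≈id) (Equiv.sym identityʳ))

      m̃s≈δm : m̃ ∘ s ≈ δ ∘ m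
      m̃s≈δm = M̃.f∘universal≈h

      a₁s≈id : a₁ ∘ s ≈ id
      a₁s≈id = m-mono (begin
        m ∘ (a₁ ∘ s) ≈⟨ pullˡ (Equiv.sym T.commute) ⟩
        (q₁ ∘ m̃) ∘ s ≈⟨ pullʳ m̃s≈δm ⟩
        q₁ ∘ (δ ∘ m) ≈⟨ cancelˡ q₁δ≈id ⟩
        m            ≈⟨ Equiv.sym identityʳ ⟩
        m ∘ id       ∎)

      -- This makes the pushout of `m` and `s` exist and be Van Kampen, so that its coprojections
      -- cover it.
      s∈𝒩 : s ∈ 𝒩
      s∈𝒩 = proj₂ (splitMonos (a₁ , a₁s≈id))

      open Pushout (pushouts m s m∈ℳ s∈𝒩)
        renaming (Q to K; i₁ to j₁; i₂ to j₂; isPushout to union) public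
      private
        module K = IsPushout union

      k : K ⇒ R
      k = K.universal (Equiv.sym m̃s≈δm)

      kj₁≈δ : k ∘ j₁ ≈ δ
      kj₁≈δ = K.universal∘n≈h

      kj₂≈m̃ : k ∘ j₂ ≈ m̃
      kj₂≈m̃ = K.universal∘g≈k

      -- Inside `R` the diagonal and `U` meet in `A`: applying `q₁` gives `x ≈ m ∘ (a₁ ∘ y)`,
      -- cancelling `m̃` gives `y ≈ s ∘ (a₁ ∘ y)`, and `K` identifies the images of both.
      diagonal∩U : ∀ {Z} {x : Z ⇒ B} {y : Z ⇒ U} → δ ∘ x ≈ m̃ ∘ y → j₁ ∘ x ≈ j₂ ∘ y
      diagonal∩U {x = x} {y} eq = begin
        j₁ ∘ x              ≈⟨ refl⟩∘⟨ Equiv.sym ma₁y≈x ⟩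
        j₁ ∘ (m ∘ (a₁ ∘ y)) ≈⟨ pullˡ K.commute ⟩
        (j₂ ∘ s) ∘ (a₁ ∘ y) ≈⟨ pullʳ sa₁y≈y ⟩
        j₂ ∘ y              ∎
        where
        ma₁y≈x : m ∘ (a₁ ∘ y) ≈ x
        ma₁y≈x = begin
          m ∘ (a₁ ∘ y) ≈⟨ pullˡ (Equiv.sym T.commute) ⟩
          (q₁ ∘ m̃) ∘ y ≈⟨ pullʳ (Equiv.sym eq) ⟩
          q₁ ∘ (δ ∘ x) ≈⟨ cancelˡ q₁δ≈id ⟩
          x            ∎
        sa₁y≈y : s ∘ (a₁ ∘ y) ≈ y
        sa₁y≈y = m̃-mono (begin
          m̃ ∘ (s ∘ (a₁ ∘ y)) ≈⟨ pullˡ m̃s≈δm ⟩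
          (δ ∘ m) ∘ (a₁ ∘ y) ≈⟨ pullʳ ma₁y≈x ⟩
          δ ∘ x              ≈⟨ eq ⟩
          m̃ ∘ y              ∎)

      union-cover : Covers (generated j₁ j₂)
      union-cover = coprojections-cover m∈ℳ s∈𝒩 union

      -- `δ` is split by `q₁` and `m̃` is monic, which settles arrows through the same leg; the
      -- mixed cases are `diagonal∩U`.
      k-injective-on-union : ∀ {Z} {f g : Z ⇒ K} → Factors j₁ j₂ f → Factors j₁ j₂ g →
                             k ∘ f ≈ k ∘ g → f ≈ g
      k-injective-on-union {f = f} {g} = cases
        where
        image₁ : ∀ {Z} {f : Z ⇒ K} {u} → f ≈ j₁ ∘ u → k ∘ f ≈ δ ∘ u
        image₁ p = Equiv.trans (refl⟩∘⟨ p) (pullˡ kj₁≈δ)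
        image₂ : ∀ {Z} {f : Z ⇒ K} {v} → f ≈ j₂ ∘ v → k ∘ f ≈ m̃ ∘ v
        image₂ p = Equiv.trans (refl⟩∘⟨ p) (pullˡ kj₂≈m̃)
        cases : Factors j₁ j₂ f → Factors j₁ j₂ g → k ∘ f ≈ k ∘ g → f ≈ g
        cases (via₁ u p) (via₁ u′ p′) eq = begin
          f       ≈⟨ p ⟩
          j₁ ∘ u  ≈⟨ refl⟩∘⟨ (begin
            u             ≈⟨ Equiv.sym (cancelˡ q₁δ≈id) ⟩
            q₁ ∘ (δ ∘ u)  ≈⟨ refl⟩∘⟨ Equiv.trans (Equiv.sym (image₁ p))
                                       (Equiv.trans eq (image₁ p′)) ⟩
            q₁ ∘ (δ ∘ u′) ≈⟨ cancelˡ q₁δ≈id ⟩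
            u′            ∎) ⟩
          j₁ ∘ u′ ≈⟨ Equiv.sym p′ ⟩
          g       ∎
        cases (via₁ u p) (via₂ v′ p′) eq = Equiv.trans p (Equiv.trans
          (diagonal∩U (Equiv.trans (Equiv.sym (image₁ p)) (Equiv.trans eq (image₂ p′))))
          (Equiv.sym p′))
        cases (via₂ v p) (via₁ u′ p′) eq = Equiv.trans p (Equiv.trans (Equiv.sym
          (diagonal∩U (Equiv.trans (Equiv.sym (image₁ p′))
                                   (Equiv.trans (Equiv.sym eq) (image₂ p)))))
          (Equiv.sym p′))
        cases (via₂ v p) (via₂ v′ p′) eq = Equiv.trans p (Equiv.trans
          (refl⟩∘⟨ m̃-mono (Equiv.trans (Equiv.sym (image₂ p)) (Equiv.trans eq (image₂ p′))))
          (Equiv.sym p′))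

      k-mono : IsMono X k
      k-mono {f = f} {g} eq =
        -- Two successive restrictions: the first makes `f` factor through `j₁` or `j₂`, the second
        -- does so for `g`.
        covering-separates {S = generated j₁ j₂} union-cover f λ t ft →
        covering-separates {S = generated j₁ j₂} union-cover (g ∘ t) λ t′ gtt′ →
          k-injective-on-union (Sieve.closed (generated j₁ j₂) t′ ft) gtt′
            (begin
              k ∘ ((f ∘ t) ∘ t′) ≈⟨ pullˡ (pullˡ eq) ⟩
              ((k ∘ g) ∘ t) ∘ t′ ≈⟨ assoc ⟩∘⟨refl ⟩
              (k ∘ (g ∘ t)) ∘ t′ ≈⟨ assoc ⟩
              k ∘ ((g ∘ t) ∘ t′) ∎)

      -- Pasted to the union square it gives the pushout of `m` along `a₁ ∘ s ≈ id`, so it is a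
      -- pushout by cancellation; the induced arrow is `h ∘ j₁`.
      union-over-a₁ : IsPushout X j₂ a₁ (q₁ ∘ k) m
      union-over-a₁ = record
        { commute = begin
            (q₁ ∘ k) ∘ j₂ ≈⟨ pullʳ kj₂≈m̃ ⟩
            q₁ ∘ m̃        ≈⟨ T.commute ⟩
            m ∘ a₁        ∎
        ; universal = λ {_} {h} _ → h ∘ j₁
        ; universal∘n≈h = λ {_} {h} {l} {eq} → pushout-jointly-epic union
            (begin
              ((h ∘ j₁) ∘ (q₁ ∘ k)) ∘ j₁ ≈⟨ pullʳ (pullʳ kj₁≈δ) ⟩
              (h ∘ j₁) ∘ (q₁ ∘ δ)        ≈⟨ refl⟩∘⟨ q₁δ≈id ⟩
              (h ∘ j₁) ∘ id              ≈⟨ identityʳ ⟩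
              h ∘ j₁                     ∎)
            (begin
              ((h ∘ j₁) ∘ (q₁ ∘ k)) ∘ j₂ ≈⟨ pullʳ (pullʳ kj₂≈m̃) ⟩
              (h ∘ j₁) ∘ (q₁ ∘ m̃)        ≈⟨ refl⟩∘⟨ T.commute ⟩
              (h ∘ j₁) ∘ (m ∘ a₁)        ≈⟨ pullˡ (restriction eq) ⟩
              l ∘ a₁                     ≈⟨ Equiv.sym eq ⟩
              h ∘ j₂                     ∎)
        ; universal∘g≈k = λ {_} {_} {_} {eq} → restriction eq
        ; unique = λ {_} {h} {_} {_} {u} p _ → begin
            u                    ≈⟨ Equiv.sym identityʳ ⟩
            u ∘ id               ≈⟨ refl⟩∘⟨ Equiv.sym q₁δ≈id ⟩
            u ∘ (q₁ ∘ δ)         ≈⟨ refl⟩∘⟨ Equiv.sym (pullʳ kj₁≈δ) ⟩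
            u ∘ ((q₁ ∘ k) ∘ j₁)  ≈⟨ pullˡ p ⟩
            h ∘ j₁               ∎
        }
        where
        restriction : ∀ {Z} {h : K ⇒ Z} {l : A ⇒ Z} → h ∘ j₂ ≈ l ∘ a₁ → (h ∘ j₁) ∘ m ≈ l
        restriction {h = h} {l} eq = begin
          (h ∘ j₁) ∘ m ≈⟨ pullʳ K.commute ⟩
          h ∘ (j₂ ∘ s) ≈⟨ pullˡ eq ⟩
          (l ∘ a₁) ∘ s ≈⟨ cancelʳ a₁s≈id ⟩
          l            ∎

      -- Van Kampen cube over `top` with `union-over-a₁` as top face, `b = k` and identities as the
      -- other vertical edges; monicity of `k` makes the face over `m̃` a pullback. The front face
      -- then exhibits `k` as a pullback of an identity along `q₁`.
      k-splitEpi : Σ[ r ∈ R ⇒ K ] k ∘ r ≈ id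
      k-splitEpi = IsPullback.universal front eq , IsPullback.m∘universal≈k front
        where
        front : IsPullback X (q₁ ∘ k) k id q₁
        front = proj₁ (Equivalence.to
          (vanKampen m̃∈ℳ a₁∈𝒩 top j₂ a₁ (q₁ ∘ k) m id k id id
            (IsPushout.commute union-over-a₁) identityˡ
            (Equiv.trans identityˡ (Equiv.sym identityʳ))
            pullback-j₂ (id-pullback a₁))
          union-over-a₁)
          where
          pullback-j₂ : IsPullback X j₂ id k m̃
          pullback-j₂ = mono-factor-pullback k-mono kj₂≈m̃
        eq : id ∘ q₁ ≈ q₁ ∘ id
        eq = Equiv.trans identityˡ (Equiv.sym identityʳ)

    -- Gluing sections of a sheaf over a pushout.

    module Gluing (P : Sheaf X κ canonical) where
      open Sheaf P
      open Functor presheaf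
      private
        module P {V} = Setoid (F₀ V)

        infixl 7 _∙_
        infix 4 _≋ₚ_

        _∙_ : ∀ {U V} → P.Carrier {U} → V ⇒ U → P.Carrier {V}
        _∙_ = _·_ presheaf

        _≋ₚ_ : ∀ {U} → P.Carrier {U} → P.Carrier {U} → Set κ
        _≋ₚ_ = _≋_ presheaf

      sections-equal : ∀ {d d′ : P.Carrier {D}} →
        d ∙ i₁ ≋ₚ d′ ∙ i₁ → d ∙ i₂ ≋ₚ d′ ∙ i₂ → d ≋ₚ d′
      sections-equal {d} {d′} eq₁ eq₂ =
        separated presheaf {S = generated i₁ i₂} (isSheaf (coprojections-cover m∈ℳ n∈𝒩 po)) λ where
          (via₁ u p) → along eq₁ p
          (via₂ v p) → along eq₂ p
        where
        along : ∀ {V W} {i : W ⇒ D} {f : V ⇒ D} {u : V ⇒ W} →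
                d ∙ i ≋ₚ d′ ∙ i → f ≈ i ∘ u → d ∙ f ≋ₚ d′ ∙ f
        along {u = u} eq p = P.trans (F-resp-≈ p d) (P.trans (homomorphism d)
          (P.trans (cong (F₁ u) eq)
          (P.trans (P.sym (homomorphism d′)) (F-resp-≈ (Equiv.sym p) d′))))

      module _ {b : P.Carrier {B}} {c : P.Carrier {C}} (agree : b ∙ m ≋ₚ c ∙ n) where

        agree-along : ∀ {V} (w : V ⇒ A) → b ∙ (m ∘ w) ≋ₚ c ∙ (n ∘ w)
        agree-along w = P.trans (homomorphism b)
          (P.trans (cong (F₁ w) agree) (P.sym (homomorphism c)))

        module R = Pullback (hasPullbacks i₁ i₁)
        open KernelPair R.isPullback

        -- As `k ∘ r ≈ id`, it suffices to compare the restrictions to `K`, and there those to the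
        -- covering pieces `B` and `U`.
        kernelPair-coequalises : b ∙ R.p₁ ≋ₚ b ∙ R.p₂
        kernelPair-coequalises = P.trans (split R.p₁)
          (P.trans (cong (F₁ r) on-union) (P.sym (split R.p₂)))
          where
          r = proj₁ k-splitEpi

          split : (q : R.P ⇒ B) → b ∙ q ≋ₚ b ∙ (q ∘ k) ∙ r
          split q = P.trans
            (F-resp-≈ (Equiv.sym (cancelʳ (proj₂ k-splitEpi))) b) (homomorphism b)

          on-union : b ∙ (R.p₁ ∘ k) ≋ₚ b ∙ (R.p₂ ∘ k)
          on-union = separated presheaf {S = generated j₁ j₂} (isSheaf union-cover)
            λ s → P.trans (P.sym (homomorphism b)) (P.trans (pointwise s) (homomorphism b))
            where
            on-diagonal : ∀ {V q f} {u : V ⇒ B} → q ∘ δ ≈ id → f ≈ j₁ ∘ u → (q ∘ k) ∘ f ≈ u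
            on-diagonal {q = q} {f} {u} qδ p = begin
              (q ∘ k) ∘ f        ≈⟨ refl⟩∘⟨ p ⟩
              (q ∘ k) ∘ (j₁ ∘ u) ≈⟨ pullˡ (pullʳ kj₁≈δ) ⟩
              (q ∘ δ) ∘ u        ≈⟨ qδ ⟩∘⟨refl ⟩
              id ∘ u             ≈⟨ identityˡ ⟩
              u                  ∎

            on-U : ∀ {V q f a} {v : V ⇒ U} → q ∘ m̃ ≈ m ∘ a → f ≈ j₂ ∘ v →
                   (q ∘ k) ∘ f ≈ m ∘ (a ∘ v)
            on-U {q = q} {f} {a} {v} eq p = begin
              (q ∘ k) ∘ f        ≈⟨ refl⟩∘⟨ p ⟩
              (q ∘ k) ∘ (j₂ ∘ v) ≈⟨ pullˡ (pullʳ kj₂≈m̃) ⟩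
              (q ∘ m̃) ∘ v        ≈⟨ eq ⟩∘⟨refl ⟩
              (m ∘ a) ∘ v        ≈⟨ assoc ⟩
              m ∘ (a ∘ v)        ∎

            pointwise : ∀ {V} {f : V ⇒ K} → Factors j₁ j₂ f →
                        b ∙ ((R.p₁ ∘ k) ∘ f) ≋ₚ b ∙ ((R.p₂ ∘ k) ∘ f)
            pointwise (via₁ u p) = F-resp-≈
              (Equiv.trans (on-diagonal q₁δ≈id p) (Equiv.sym (on-diagonal q₂δ≈id p))) b
            -- On `U` the section `b` is exchanged for `c` along `a₁`, moved across
            -- `n ∘ a₁ ≈ n ∘ a₂`, and exchanged back along `a₂`.
            pointwise (via₂ v p) =
              P.trans (F-resp-≈ (on-U (IsPushout.commute top) p) b)
              (P.trans (agree-along (a₁ ∘ v))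
              (P.trans (F-resp-≈ (Equiv.trans (pullˡ (IsPullback.commute a-kernelPair)) assoc) c)
              (P.trans (P.sym (agree-along (a₂ ∘ v)))
                       (F-resp-≈ (Equiv.sym (on-U (IsPullback.commute m̃-pullback) p)) b))))

        value : ∀ {V} {f : V ⇒ D} → Factors i₁ i₂ f → P.Carrier {V}
        value (via₁ u _) = b ∙ u
        value (via₂ v _) = c ∙ v

        -- The pushout square is also a pullback, so `u` and `v` come from one arrow into `A`, where
        -- `b` and `c` agree.
        value₁₂ : ∀ {V} {u : V ⇒ B} {v : V ⇒ C} → i₁ ∘ u ≈ i₂ ∘ v → b ∙ u ≋ₚ c ∙ v
        value₁₂ eq = P.trans (F-resp-≈ (Equiv.sym PB.f∘universal≈h) b)
          (P.trans (agree-along (PB.universal eq)) (F-resp-≈ PB.m∘universal≈k c))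
          where module PB = IsPullback (pushout-isPullback m∈ℳ n∈𝒩 po)

        -- Two factorisations through `B` differ by the kernel pair of `i₁`, mixed ones meet in `A`,
        -- and two through `C` coincide because `i₂` is monic.
        value-unique : ∀ {V} {f g : V ⇒ D} (s : Factors i₁ i₂ f) (t : Factors i₁ i₂ g) →
                       f ≈ g → value s ≋ₚ value t
        value-unique (via₁ u p) (via₁ u′ p′) eq =
          P.trans (P.trans (F-resp-≈ (Equiv.sym K.f∘universal≈h) b) (homomorphism b))
          (P.trans (cong (F₁ (K.universal eq′)) kernelPair-coequalises)
                   (P.trans (P.sym (homomorphism b)) (F-resp-≈ K.m∘universal≈k b)))
          where
          module K = IsPullback R.isPullback
          eq′ = Equiv.trans (Equiv.sym p) (Equiv.trans eq p′)
        value-unique (via₁ u p) (via₂ v′ p′) eq =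
          value₁₂ (Equiv.trans (Equiv.sym p) (Equiv.trans eq p′))
        value-unique (via₂ v p) (via₁ u′ p′) eq =
          P.sym (value₁₂ (Equiv.trans (Equiv.sym p′) (Equiv.trans (Equiv.sym eq) p)))
        value-unique (via₂ v p) (via₂ v′ p′) eq =
          F-resp-≈ (i₂-mono m∈ℳ n∈𝒩 po (Equiv.trans (Equiv.sym p) (Equiv.trans eq p′))) c

        value-closed : ∀ {V W} {f : V ⇒ D} (g : W ⇒ V) (s : Factors i₁ i₂ f) →
                       value s ∙ g ≋ₚ value (Sieve.closed (generated i₁ i₂) g s)
        value-closed g (via₁ u p) = P.sym (homomorphism b)
        value-closed g (via₂ v p) = P.sym (homomorphism c)

        glue : Σ[ d ∈ P.Carrier {D} ] (d ∙ i₁ ≋ₚ b × d ∙ i₂ ≋ₚ c)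
        glue = proj₁ glued
             -- `value` reads off the factorisation, so `i₁` is presented as `i₁ ∘ id`, with value
             -- `b ∙ id`.
             , P.trans (proj₁ (proj₂ glued) (via₁ id (Equiv.sym identityʳ))) (identity b)
             , P.trans (proj₁ (proj₂ glued) (via₂ id (Equiv.sym identityʳ))) (identity c)
          where
          glued = isSheaf {S = generated i₁ i₂} (coprojections-cover m∈ℳ n∈𝒩 po) record
            { section      = λ _ → value
            ; section-cong = value-unique
            ; matching     = λ g s t → P.trans (value-closed g s)
                (value-unique (Sieve.closed (generated i₁ i₂) g s) t Equiv.refl)
            }

  -- Pushouts under the Yoneda embedding.

  open NaturalTransformation

  -- By Yoneda's lemma a cocone with vertex a sheaf `P` amounts to two sections of `P` that agree
  -- along `m` and `n`, and the induced transformation is the one named by the glued section.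
  yoneda-preservesPushouts : PreservesPushoutsOf yoneda ℳ 𝒩
  yoneda-preservesPushouts {m = m} {n} {i₁} {i₂} m∈ℳ n∈𝒩 po = record
    { commute         = λ V u → lift (Equiv.trans (pullˡ (IsPushout.commute po)) assoc)
    ; universal       = λ {P} {h} {l} eq → fromElement (proj₁ (glued P h l eq))
    ; universal∘n≈h   = λ {P} {h} {l} {eq} V u →
        restricts P h (proj₁ (proj₂ (glued P h l eq))) u
    ; universal∘g≈k   = λ {P} {h} {l} {eq} V u →
        restricts P l (proj₂ (proj₂ (glued P h l eq))) u
    ; unique          = λ {P} {h} {l} {eq} {α} p q V u →
        let module P {V} = Setoid (Functor.F₀ (Sheaf.presheaf P) V)
            d , d-i₁ , d-i₂ = glued P h l eq
        -- `α` is determined by its element, which is compared with `d` on the two coprojections.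
        in P.trans (element-· α (lower u)) (cong (Functor.F₁ (Sheaf.presheaf P) (lower u))
             (Gluing.sections-equal m∈ℳ n∈𝒩 po P
               (P.trans (restricted P α {h} p) (P.sym d-i₁))
               (P.trans (restricted P α {l} q) (P.sym d-i₂))))
    }
    where
    open Category (Sh canonical) using () renaming (_⇒_ to _⇒ₛ_; _≈_ to _≈ₛ_; _∘_ to _∘ₛ_)
    open Functor yoneda using () renaming (F₀ to y₀; F₁ to y₁)

    glued : ∀ P (h : y₀ _ ⇒ₛ P) (l : y₀ _ ⇒ₛ P) →
            _≈ₛ_ {y₀ _} {P} (_∘ₛ_ {y₀ _} {y₀ _} {P} h (y₁ m)) (_∘ₛ_ {y₀ _} {y₀ _} {P} l (y₁ n)) → _
    glued P h l eq = Gluing.glue m∈ℳ n∈𝒩 po P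
      -- Evaluating `eq` at the identity turns commutation of the cocone into agreement of the two
      -- elements.
      (P.trans (P.sym (element-· h m))
      (P.trans (cong (η h _) (lift (Equiv.sym identityʳ)))
      (P.trans (eq _ (lift id))
      (P.trans (cong (η l _) (lift identityʳ)) (element-· l n)))))
      where module P {V} = Setoid (Functor.F₀ (Sheaf.presheaf P) V)

    module _ (P : Sheaf X κ canonical) where
      open Functor (Sheaf.presheaf P)
      private
        module P {V} = Setoid (F₀ V)

      restricts : ∀ {W D} {i : W ⇒ D} {d : P.Carrier {D}} (h : y₀ W ⇒ₛ P) →
        to (F₁ i) d P.≈ element h → ∀ {V} (u : Lift κ (V ⇒ W)) →
        to (F₁ (i ∘ lower u)) d P.≈ to (η h V) u
      restricts {d = d} h eq u = P.trans (homomorphism d)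
        (P.trans (cong (F₁ (lower u)) eq) (P.sym (element-· h (lower u))))

      restricted : ∀ {W D} {i : W ⇒ D} (α : y₀ D ⇒ₛ P) {h : y₀ W ⇒ₛ P} →
        _≈ₛ_ {y₀ W} {P} (_∘ₛ_ {y₀ W} {y₀ D} {P} α (y₁ i)) h →
        to (F₁ i) (element α) P.≈ element h
      restricted {i = i} α p = P.trans (P.sym (element-· α i))
        (P.trans (cong (η α _) (lift (Equiv.sym identityʳ))) (p _ (lift id)))

corollary6p7 : ∀ {o ℓ e p q : Level} (X : Category o ℓ e)
    (ℳ : ArrowClass X p) (𝒩 : ArrowClass X q) →
    IsAdhesive X ℳ 𝒩 →
    HasPullbacks X →
    ContainSplitMonos X ℳ 𝒩 →
    ContainsCodiagonals X ℳ 𝒩 →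
    Σ[ J ∈ GrothendieckTopology X (o ⊔ ℓ ⊔ e) ]
    Σ[ F ∈ Functor X (Sh J) ]
    (Full F × Faithful F × PreservesPullbacks F × PreservesPushoutsOf F ℳ 𝒩)
corollary6p7 X ℳ 𝒩 adhesive hasPullbacks splitMonos _ =
    canonical , yoneda , yoneda-full , (λ {_} {_} {f} {g} → yoneda-faithful {f = f} {g})
  , yoneda-preservesPullbacks , yoneda-preservesPushouts
  where
  open Canonical X
  open Adhesive X ℳ 𝒩 adhesive hasPullbacks splitMonos
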